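{- Let $G$ be a finite, simple, connected graph with $res_{wt}(G)=k$. Then the maximum degree of $G$ satisfies $\Delta(G)\le 2^{k-1}+k-1$.
   Context: $d(x,y)$ is the shortest-path distance. A set $W\subseteq V(G)$ is a resolving set if for every two distinct vertices $y,z$ there is $x\in W$ with $d(y,x)\ne d(z,x)$. A set $W$ is a weak total resolving set (WTR-set) if $W$ is resolving and, for every $w\in W$ and every $x\in V(G)\setminus W$, there is $w'\in W\setminus\{w\}$ with $d(x,w')\ne d(w,w')$. The weak total resolving number $res_{wt}(G)$ is the minimum positive integer $r$ such that every set of $r$ vertices of $G$ is a WTR-set for $G$. -}

module Defs where

open import Data.Fin.Base using (Fin)
open import Data.Fin.Properties using (_≟_; all?; any?)
open import Data.Fin.Subset using (Subset; ∣_∣; _∈_; _∉_)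
open import Data.Fin.Subset.Properties using (_∈?_; anySubset?; ∣p∣≡n⇒p≡⊤; ∈⊤)
open import Data.List.Base using (map; allFin)
open import Data.List.Extrema.Nat using (max)
open import Data.Nat.Base using (ℕ; zero; suc; _≤_; z≤n; s≤s; NonZero; >-nonZero⁻¹)
open import Data.Nat.Properties using (_≤?_; n≤0⇒n≡0)
import Data.Nat.Properties as ℕ
open import Data.Product.Base using (∃; _×_; _,_; proj₁; proj₂)
open import Data.Vec.Base using (tabulate)
open import Function.Base using (_∘_)
open import Level using (0ℓ)
open import Relation.Binary.Core using (Rel)
import Relation.Binary.Definitions as B
open import Relation.Binary.PropositionalEquality
  using (_≡_; _≢_; refl; sym; trans; subst)
open import Relation.Nullary.Decidable
  using (Dec; yes; no; does; map′; ¬?; _×-dec_; _→-dec_; decidable-stable)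
open import Relation.Nullary.Negation using (contradiction)
open import Relation.Unary using (Pred; Decidable)

IsMinimum : Pred ℕ 0ℓ → Pred ℕ 0ℓ
IsMinimum P m = P m × (∀ k → P k → m ≤ k)

minimum : {P : Pred ℕ 0ℓ} → Decidable P → ∃ P → ∃ (IsMinimum P)
minimum P? (n , Pn) = search P? n Pn
  where
  search : {P : Pred ℕ 0ℓ} → Decidable P → ∀ n → P n → ∃ (IsMinimum P)
  search {P} P? n Pn with P? 0
  search {P} P? n       Pn | yes P0 = 0 , P0 , λ _ _ → z≤n
  search {P} P? zero    Pn | no ¬P0 = contradiction Pn ¬P0
  search {P} P? (suc n) Pn | no ¬P0 with search (P? ∘ suc) n Pn
  ... | m , Pm , m≤ = suc m , Pm , λ where
    zero    P0 → contradiction P0 ¬P0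
    (suc k) Pk → s≤s (m≤ k Pk)

record Graph (n : ℕ) : Set₁ where
  field
    Adj    : Rel (Fin n) 0ℓ
    adj?   : B.Decidable Adj
    symm   : B.Symmetric Adj
    irrefl : B.Irreflexive _≡_ Adj

module _ {n : ℕ} (G : Graph n) where
  open Graph G

  -- Walk l x y: a walk with exactly l edges from x to y.
  data Walk : ℕ → Fin n → Fin n → Set where
    nil  : ∀ {x} → Walk 0 x x
    cons : ∀ {l x y z} → Adj x y → Walk l y z → Walk (suc l) x z

  walk? : ∀ l x y → Dec (Walk l x y)
  walk? zero    x y = map′ (λ where refl → nil) (λ where nil → refl) (x ≟ y)
  walk? (suc l) x y = map′ (λ where (_ , a , w) → cons a w)
                           (λ where (cons a w) → _ , a , w)
                           (any? λ z → adj? x z ×-dec walk? l z y)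

  -- The graph without vertices does not count as connected.
  Connected : Set
  Connected = NonZero n × (∀ x y → ∃ λ l → Walk l x y)

  neighbours : Fin n → Subset n
  neighbours x = tabulate λ y → does (adj? x y)

  degree : Fin n → ℕ
  degree x = ∣ neighbours x ∣

  maxDegree : ℕ
  maxDegree = max 0 (map degree (allFin n))

  module _ (conn : Connected) where

    -- A walk of minimum length repeats no vertex, so this is the length of a
    -- shortest path.
    shortest : ∀ x y → ∃ (IsMinimum λ l → Walk l x y)
    shortest x y = minimum (λ l → walk? l x y) (proj₂ conn x y)

    dist : Fin n → Fin n → ℕ
    dist x y = proj₁ (shortest x y)

    IsResolving : Pred (Subset n) 0ℓ
    IsResolving W = ∀ y z → y ≢ z → ∃ λ x → x ∈ W × dist y x ≢ dist z x

    IsWTR : Pred (Subset n) 0ℓ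
    IsWTR W = IsResolving W ×
      (∀ w → w ∈ W → ∀ x → x ∉ W →
        ∃ λ w′ → (w′ ∈ W × w′ ≢ w) × dist x w′ ≢ dist w w′)

    AllWTR : Pred ℕ 0ℓ
    AllWTR r = 1 ≤ r × (∀ (W : Subset n) → ∣ W ∣ ≡ r → IsWTR W)

    isWTR? : Decidable IsWTR
    isWTR? W =
      (all? λ y → all? λ z → ¬? (y ≟ z) →-dec
        any? λ x → x ∈? W ×-dec ¬? (dist y x ℕ.≟ dist z x))
      ×-dec
      (all? λ w → w ∈? W →-dec all? λ x → ¬? (x ∈? W) →-dec
        any? λ w′ → (w′ ∈? W ×-dec ¬? (w′ ≟ w))
          ×-dec ¬? (dist x w′ ℕ.≟ dist w w′))

    allWTR? : Decidable AllWTR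
    allWTR? r = 1 ≤? r ×-dec
      map′ (λ ¬∃ W → decidable-stable (P? W) λ ¬p → ¬∃ (W , ¬p))
           (λ p (W , ¬p) → ¬p (p W))
           (¬? (anySubset? (¬? ∘ P?)))
      where
      P? : ∀ W → Dec (∣ W ∣ ≡ r → IsWTR W)
      P? W = (∣ W ∣ ℕ.≟ r) →-dec isWTR? W

    dist-refl : ∀ x → dist x x ≡ 0
    dist-refl x = n≤0⇒n≡0 (proj₂ (proj₂ (shortest x x)) 0 nil)

    dist≡0⇒≡ : ∀ {x y} → dist x y ≡ 0 → x ≡ y
    dist≡0⇒≡ {x} {y} eq
      with nil ← subst (λ l → Walk l x y) eq (proj₁ (proj₂ (shortest x y))) = refl

    -- The set of all vertices is a WTR-set, so the number of vertices qualifies.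
    allWTR-n : AllWTR n
    allWTR-n = >-nonZero⁻¹ n {{proj₁ conn}} , λ W ∣W∣≡n →
      let full : ∀ x → x ∈ W
          full x = subst (x ∈_) (sym (∣p∣≡n⇒p≡⊤ ∣W∣≡n)) ∈⊤
      in (λ y z y≢z → z , full z , λ eq →
            y≢z (dist≡0⇒≡ (trans eq (dist-refl z))))
       , (λ w _ x x∉W → contradiction (full x) x∉W)

    weakTotalResolvingNumber : ∃ (IsMinimum AllWTR)
    weakTotalResolvingNumber = minimum allWTR? (n , allWTR-n)

    resWT : ℕ
    resWT = proj₁ weakTotalResolvingNumber

{-# OPTIONS --safe #-}

-- Write k = m + 1. If v has at least m neighbours, choose m of them, forming a
-- set S. Since S ∪ ⁅ v ⁆ has k elements it is resolving. All neighbours of v are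
-- at distance 1 from v, so those outside S are told apart by S alone, and their
-- distances to S take only the values 1 and 2. Hence there are at most 2 ^ m of
-- them.
module Submission where

open import Defs
open import Data.Bool.Base using (Bool)
open import Data.Fin.Base using (Fin; zero; suc)
import Data.Fin.Properties as Fin
open import Data.Fin.Subset
open import Data.Fin.Subset.Properties
open import Data.List.Base using (allFin)
open import Data.List.Extrema.Nat using (max≤v⁺)
import Data.List.Relation.Unary.All as All
import Data.List.Relation.Unary.All.Properties as All
open import Data.Nat.Base using (ℕ; zero; suc; _+_; _∸_; _^_; _≤_; z≤n; s≤s; s≤s⁻¹)
open import Data.Nat.Properties
open import Data.Product.Base using (∃; _×_; _,_; proj₁; proj₂)
open import Data.Sum.Base using (inj₁; inj₂)
open import Data.Vec.Base using ([]; _∷_; tabulate; here; there)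
open import Data.Vec.Properties using (lookup∘tabulate; []=⇒lookup; lookup⇒[]=)
open import Function.Base using (_∘_)
open import Relation.Binary.PropositionalEquality
  using (_≡_; _≢_; refl; sym; trans; cong; subst)
open import Relation.Nullary.Decidable using (yes; does; decidable-stable)
open import Relation.Nullary.Negation using (contradiction)

private
  variable
    n l : ℕ

∣p∣≡∣p∩q∣+∣p∩∁q∣ : ∀ (p q : Subset n) → ∣ p ∣ ≡ ∣ p ∩ q ∣ + ∣ p ∩ ∁ q ∣
∣p∣≡∣p∩q∣+∣p∩∁q∣ []            []            = refl
∣p∣≡∣p∩q∣+∣p∩∁q∣ (outside ∷ p) (_ ∷ q)       = ∣p∣≡∣p∩q∣+∣p∩∁q∣ p q
∣p∣≡∣p∩q∣+∣p∩∁q∣ (inside ∷ p)  (inside ∷ q)  = cong suc (∣p∣≡∣p∩q∣+∣p∩∁q∣ p q)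
∣p∣≡∣p∩q∣+∣p∩∁q∣ (inside ∷ p)  (outside ∷ q) =
  trans (cong suc (∣p∣≡∣p∩q∣+∣p∩∁q∣ p q)) (sym (+-suc ∣ p ∩ q ∣ ∣ p ∩ ∁ q ∣))

x∉p⇒∣p∪⁅x⁆∣≡1+∣p∣ : ∀ (p : Subset n) x → x ∉ p → ∣ p ∪ ⁅ x ⁆ ∣ ≡ suc ∣ p ∣
x∉p⇒∣p∪⁅x⁆∣≡1+∣p∣ (inside ∷ p)  zero    x∉p = contradiction here x∉p
x∉p⇒∣p∪⁅x⁆∣≡1+∣p∣ (outside ∷ p) zero    x∉p = cong (suc ∘ ∣_∣) (∪-identityʳ p)
x∉p⇒∣p∪⁅x⁆∣≡1+∣p∣ (inside ∷ p)  (suc x) x∉p =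
  cong suc (x∉p⇒∣p∪⁅x⁆∣≡1+∣p∣ p x (x∉p ∘ there))
x∉p⇒∣p∪⁅x⁆∣≡1+∣p∣ (outside ∷ p) (suc x) x∉p = x∉p⇒∣p∪⁅x⁆∣≡1+∣p∣ p x (x∉p ∘ there)

subset-of-size : ∀ (p : Subset n) {m} → m ≤ ∣ p ∣ → ∃ λ q → q ⊆ p × ∣ q ∣ ≡ m
subset-of-size {n} p {zero}  m≤∣p∣ = ⊥ , ⊆-min p , ∣⊥∣≡0 n
subset-of-size (outside ∷ p) {suc m} m≤∣p∣ with subset-of-size p m≤∣p∣
... | q , q⊆p , ∣q∣≡m = outside ∷ q , out⊆ q⊆p , ∣q∣≡m
subset-of-size (inside ∷ p) {suc m} m≤∣p∣ with subset-of-size p (s≤s⁻¹ m≤∣p∣)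
... | q , q⊆p , ∣q∣≡m = inside ∷ q , in⊆in q⊆p , cong suc ∣q∣≡m

∣p∣≤1 : ∀ (p : Subset n) → (∀ {x y} → x ∈ p → y ∈ p → x ≡ y) → ∣ p ∣ ≤ 1
∣p∣≤1 []            _      = z≤n
∣p∣≤1 (outside ∷ p) unique =
  ∣p∣≤1 p λ x∈p y∈p → Fin.suc-injective (unique (there x∈p) (there y∈p))
∣p∣≤1 {suc n} (inside ∷ p) unique = s≤s (≤-reflexive (trans (cong ∣_∣ p≡⊥) (∣⊥∣≡0 n)))
  where
  p≡⊥ : p ≡ ⊥
  p≡⊥ = Empty-unique λ (x , x∈p) → contradiction (unique here (there x∈p)) λ ()

∈-tabulate⁺ : ∀ (f : Fin n → Bool) {x} → f x ≡ inside → x ∈ tabulate f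
∈-tabulate⁺ f {x} fx = lookup⇒[]= x (tabulate f) (trans (lookup∘tabulate f x) fx)

∈-tabulate⁻ : ∀ (f : Fin n → Bool) {x} → x ∈ tabulate f → f x ≡ inside
∈-tabulate⁻ f {x} x∈ = trans (sym (lookup∘tabulate f x)) ([]=⇒lookup x∈)

∈-∁tabulate⁻ : ∀ (f : Fin n → Bool) {x} → x ∈ ∁ (tabulate f) → f x ≡ outside
∈-∁tabulate⁻ f {x} x∈ with f x in fx
... | outside = refl
... | inside  = contradiction (∈-tabulate⁺ f fx) (x∈∁p⇒x∉p x∈)

-- The tests `f i` have an index type `Fin l` of their own, so that an induction can strip tests one
-- by one while the points stay in `Fin n`.
Separates : Subset l → (Fin l → Fin n → Bool) → Subset n → Set
Separates q f p = ∀ {x y} → x ∈ p → y ∈ p → x ≢ y → ∃ λ i → i ∈ q × f i x ≢ f i y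

module _ (f : Fin (suc l) → Fin n → Bool) {p : Subset n} where

  -- A test that is constant on `r` tells no two points of `r` apart, so the witness for a pair in
  -- `r` must come from the remaining tests.
  separates-tail : ∀ {s q} → Separates (s ∷ q) f p → ∀ {r b} → r ⊆ p →
                   (s ≡ inside → ∀ {x} → x ∈ r → f zero x ≡ b) → Separates q (f ∘ suc) r
  separates-tail sep r⊆p const x∈r y∈r x≢y with sep (r⊆p x∈r) (r⊆p y∈r) x≢y
  ... | zero  , here      , ≢ = contradiction (trans (const refl x∈r) (sym (const refl y∈r))) ≢
  ... | suc i , there i∈q , ≢ = i , i∈q , ≢

-- Points of `p` have distinct bit vectors indexed by `q`. The induction on `q` realises this count:
-- each selected test splits `p` into two parts on which it is constant, and without tests at most
-- one point is left.
separates⇒∣p∣≤2^∣q∣ : ∀ (q : Subset l) (f : Fin l → Fin n → Bool) (p : Subset n) →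
                      Separates q f p → ∣ p ∣ ≤ 2 ^ ∣ q ∣
separates⇒∣p∣≤2^∣q∣ [] f p sep = ∣p∣≤1 p λ {x} {y} x∈p y∈p →
  decidable-stable (x Fin.≟ y) λ x≢y → contradiction (proj₁ (sep x∈p y∈p x≢y)) λ ()
separates⇒∣p∣≤2^∣q∣ (outside ∷ q) f p sep =
  -- The first test is not selected, so the constancy premise is vacuous and the value of `b` is
  -- arbitrary.
  separates⇒∣p∣≤2^∣q∣ q (f ∘ suc) p (separates-tail f sep {b = outside} ⊆-refl λ ())
separates⇒∣p∣≤2^∣q∣ (inside ∷ q) f p sep = begin
  ∣ p ∣                       ≡⟨ ∣p∣≡∣p∩q∣+∣p∩∁q∣ p c ⟩
  ∣ p ∩ c ∣ + ∣ p ∩ ∁ c ∣     ≤⟨ +-mono-≤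
    (bound (p ∩ c) (p∩q⊆p p c) (∈-tabulate⁻ (f zero) ∘ p∩q⊆q p c))
    (bound (p ∩ ∁ c) (p∩q⊆p p (∁ c)) (∈-∁tabulate⁻ (f zero) ∘ p∩q⊆q p (∁ c))) ⟩
  2 ^ ∣ q ∣ + 2 ^ ∣ q ∣       ≡⟨ cong (2 ^ ∣ q ∣ +_) (+-identityʳ _) ⟨
  2 ^ suc ∣ q ∣               ∎
  where
  open ≤-Reasoning
  c = tabulate (f zero)

  bound : ∀ r {b} → r ⊆ p → (∀ {x} → x ∈ r → f zero x ≡ b) → ∣ r ∣ ≤ 2 ^ ∣ q ∣
  bound r r⊆p const =
    separates⇒∣p∣≤2^∣q∣ q (f ∘ suc) r (separates-tail f sep r⊆p λ _ → const)

-- This lets a distance known to be 1 or 2 be recorded as a single bit without loss.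
≡1-determines : ∀ {a b} → 1 ≤ a → a ≤ 2 → 1 ≤ b → b ≤ 2 →
                does (a ≟ 1) ≡ does (b ≟ 1) → a ≡ b
≡1-determines {1} {1} _ _ _ _ _ = refl
≡1-determines {2} {2} _ _ _ _ _ = refl
≡1-determines {suc (suc (suc _))} _ (s≤s (s≤s ())) _ _ _
≡1-determines {_} {suc (suc (suc _))} _ _ _ (s≤s (s≤s ())) _

module _ (G : Graph n) where
  open Graph G

  ∈-neighbours⁻ : ∀ {x y} → y ∈ neighbours G x → Adj x y
  ∈-neighbours⁻ {x} {y} y∈ with adj? x y | ∈-tabulate⁻ (does ∘ adj? x) y∈
  ... | yes xy | _ = xy

  module _ (conn : Connected G) where

    dist-≤ : ∀ {m x y} → Walk G m x y → dist G conn x y ≤ m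
    dist-≤ {x = x} {y} w = proj₂ (proj₂ (shortest G conn x y)) _ w

    ≢⇒1≤dist : ∀ {x y} → x ≢ y → 1 ≤ dist G conn x y
    ≢⇒1≤dist x≢y = n≢0⇒n>0 (x≢y ∘ dist≡0⇒≡ G conn)

    Adj⇒dist≡1 : ∀ {x y} → Adj x y → dist G conn x y ≡ 1
    Adj⇒dist≡1 xy =
      ≤-antisym (dist-≤ (cons xy nil)) (≢⇒1≤dist λ x≡y → irrefl x≡y xy)

    common-neighbour⇒dist≤2 : ∀ {v x y} → Adj v x → Adj v y → dist G conn x y ≤ 2
    common-neighbour⇒dist≤2 vx vy = dist-≤ (cons (symm vx) (cons vy nil))

    module _ {v : Fin n} {S : Subset n} (S⊆N : S ⊆ neighbours G v)
             (resolving : IsResolving G conn (S ∪ ⁅ v ⁆)) where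

      private
        near : Fin n → Fin n → Bool
        near i x = does (dist G conn x i ≟ 1)

        N─S = neighbours G v ∩ ∁ S

        adj : ∀ {x} → x ∈ N─S → Adj v x
        adj x∈ = ∈-neighbours⁻ (p∩q⊆p _ _ x∈)

        1≤d≤2 : ∀ {x i} → x ∈ N─S → i ∈ S → 1 ≤ dist G conn x i × dist G conn x i ≤ 2
        1≤d≤2 x∈ i∈S =
          -- The points differ because `x` lies outside `S`; the upper bound comes from the walk
          -- through `v`.
          ≢⇒1≤dist (λ x≡i → x∈∁p⇒x∉p (p∩q⊆q _ _ x∈) (subst (_∈ S) (sym x≡i) i∈S)) ,
          common-neighbour⇒dist≤2 (adj x∈) (∈-neighbours⁻ (S⊆N i∈S))

        separates : Separates S near N─S
        separates {x} {y} x∈ y∈ x≢y with resolving x y x≢y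
        ... | i , i∈ , dx≢dy with x∈p∪q⁻ S ⁅ v ⁆ i∈
        ...   | inj₁ i∈S = i , i∈S , λ eq →
                let (1≤dx , dx≤2) = 1≤d≤2 x∈ i∈S
                    (1≤dy , dy≤2) = 1≤d≤2 y∈ i∈S
                in dx≢dy (≡1-determines 1≤dx dx≤2 1≤dy dy≤2 eq)
        -- The resolving vertex cannot be `v`, which is at distance 1 from both `x` and `y`.
        ...   | inj₂ i∈v with refl ← x∈⁅y⁆⇒x≡y v i∈v = contradiction
                (trans (Adj⇒dist≡1 (symm (adj x∈))) (sym (Adj⇒dist≡1 (symm (adj y∈))))) dx≢dy

      resolving⇒degree≤ : degree G v ≤ 2 ^ ∣ S ∣ + ∣ S ∣
      resolving⇒degree≤ = begin
        degree G v                         ≡⟨ ∣p∣≡∣p∩q∣+∣p∩∁q∣ (neighbours G v) S ⟩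
        ∣ neighbours G v ∩ S ∣ + ∣ N─S ∣   ≤⟨ +-mono-≤ (∣p∩q∣≤∣q∣ (neighbours G v) S)
                                                       (separates⇒∣p∣≤2^∣q∣ S near N─S separates) ⟩
        ∣ S ∣ + 2 ^ ∣ S ∣                  ≡⟨ +-comm ∣ S ∣ _ ⟩
        2 ^ ∣ S ∣ + ∣ S ∣                  ∎
        where open ≤-Reasoning

    AllWTR⇒degree≤ : ∀ {m} → AllWTR G conn (suc m) → ∀ v → degree G v ≤ 2 ^ m + m
    AllWTR⇒degree≤ {m} (_ , wtr) v with ≤-total m (degree G v)
    -- When the degree is at most `m`, the summand `m` alone suffices.
    ... | inj₂ d≤m = ≤-trans d≤m (m≤n+m m (2 ^ m))
    ... | inj₁ m≤d with subset-of-size (neighbours G v) m≤d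
    ...   | S , S⊆N , refl = resolving⇒degree≤ S⊆N
            (proj₁ (wtr (S ∪ ⁅ v ⁆) (x∉p⇒∣p∪⁅x⁆∣≡1+∣p∣ S v v∉S)))
      where
      v∉S : v ∉ S
      v∉S v∈S = irrefl refl (∈-neighbours⁻ (S⊆N v∈S))

theorem7 : ∀ (n : ℕ) (G : Graph n) (conn : Connected G) (k : ℕ) →
    resWT G conn ≡ k → maxDegree G ≤ 2 ^ (k ∸ 1) + (k ∸ 1)
theorem7 n G conn k refl
  with resWT G conn | proj₁ (proj₂ (weakTotalResolvingNumber G conn))
-- `AllWTR` demands `1 ≤ r`, so `k` is positive and `k ∸ 1` is its true predecessor.
... | zero  | () , _
... | suc m | wtr =
  -- `z≤n` handles the default value 0 in `maxDegree`.
  max≤v⁺ z≤n (All.map⁺ (All.universal (AllWTR⇒degree≤ G conn wtr) (allFin n)))
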